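{- Let $n_0,n_1,n_2\in\mathbb{Z}_{>0}$ and $X=[n_0;n_1,n_2]=n_0+\cfrac{1}{n_1+\cfrac{1}{n_2}}$. Then $$\mathrm{F}([n_0;n_1,n_2]) = (F_{n_1-1}L_{n_0}+F_{n_1-2}F_{n_0+1})\,F_{n_2}+(F_{n_1-2}L_{n_0}+F_{n_1-3}F_{n_0+1})\,F_{n_2+1}.$$
   Context: The conumerator function is the unique map $\mathrm{con}:\mathbb{Q}_{>0}\to\mathbb{Z}_{>0}$ with $\mathrm{con}(1)=1$ and, for all $X\in\mathbb{Q}_{>0}$, $\mathrm{con}(1+X)=\mathrm{con}(X)+\mathrm{con}(1/X)$ and $\mathrm{con}\left(\tfrac{1}{1+X}\right)=\mathrm{con}(X)$. The codenominator function is $\mathrm{F}(X):=\mathrm{con}(1/X)$ for $X\in\mathbb{Q}_{>0}$; equivalently $\mathrm{F}(1)=1$, $\mathrm{F}(1+X)=\mathrm{F}(1/X)$, $\mathrm{F}\left(\tfrac{1}{1+X}\right)=\mathrm{F}(X)+\mathrm{F}(1/X)$. The Fibonacci numbers are $F_0=0$, $F_1=1$, $F_n=F_{n-1}+F_{n-2}$, and the Lucas numbers are $L_0=2$, $L_1=1$, $L_n=L_{n-1}+L_{n-2}$; for negative indices $F_{ -n}=(-1)^{n-1}F_n$ and $L_{ -n}=(-1)^nL_n$. -}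

module Defs where

open import Data.Integer as ℤ using (ℤ; +_; -[1+_]; +[1+_]; +0; -1ℤ; 1ℤ)
open import Data.Irrelevant using ([_])
open import Data.Nat as ℕ using (ℕ; zero; suc; compare; equal; less; greater; s≤s)
open import Data.Nat.Coprimality as Coprime using (Coprime; coprime-+)
import Data.Nat.Properties as ℕ
open import Data.Rational as ℚ using (ℚ; mkℚ; 1ℚ; toℚᵘ; _/_)
import Data.Rational.Properties as ℚ
open import Data.Rational.Unnormalised as ℚᵘ using (*≡*)
import Data.Rational.Unnormalised.Properties as ℚᵘ
import Data.Integer.Properties as ℤ
open import Data.Refinement using (Refinement-syntax; _,_; value)
open import Relation.Binary.PropositionalEquality
  using (_≡_; refl; sym; trans; cong; cong₂; subst)

ℤ>0 : Set
ℤ>0 = [ n ∈ ℤ ∣ ℤ.Positive n ]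

ℚ>0 : Set
ℚ>0 = [ q ∈ ℚ ∣ ℚ.Positive q ]

infixl 6 _+⁺_
infix  8 1/⁺_

1⁺ : ℚ>0
1⁺ = 1ℚ , [ _ ]

_+⁺_ : ℚ>0 → ℚ>0 → ℚ>0
(p , [ p>0 ]) +⁺ (q , [ q>0 ]) =
  p ℚ.+ q , [ ℚ.pos+pos⇒pos p {{p>0}} q {{q>0}} ]

1/⁺_ : ℚ>0 → ℚ>0
1/⁺ (q , [ q>0 ]) =
  (ℚ.1/ q) {{ℚ.pos⇒nonZero q {{q>0}}}} , [ ℚ.1/pos⇒pos q {{q>0}} ]

/1-positive : ∀ n → ℤ.Positive n → ℚ.Positive (n / 1)
/1-positive +[1+ n ] _ = ℚ.normalize-pos (suc n) 1

fromℤ⁺ : (n : ℤ) → .{{ℤ.Positive n}} → ℚ>0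
fromℤ⁺ n {{n>0}} = n / 1 , [ /1-positive n n>0 ]

-- [n₀; n₁, n₂] = n₀ + 1/(n₁ + 1/n₂)
cf : (n₀ n₁ n₂ : ℤ) →
     .{{ℤ.Positive n₀}} → .{{ℤ.Positive n₁}} → .{{ℤ.Positive n₂}} → ℚ>0
cf n₀ n₁ n₂ = fromℤ⁺ n₀ +⁺ 1/⁺ (fromℤ⁺ n₁ +⁺ 1/⁺ fromℤ⁺ n₂)

record IsConumerator (con : ℚ>0 → ℤ>0) : Set where
  field
    con-1        : value (con 1⁺) ≡ 1ℤ
    con-1+X      : ∀ X → value (con (1⁺ +⁺ X)) ≡
                         value (con X) ℤ.+ value (con (1/⁺ X))
    con-1/[1+X]  : ∀ X → value (con (1/⁺ (1⁺ +⁺ X))) ≡ value (con X)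

codenominator : (con : ℚ>0 → ℤ>0) → ℚ>0 → ℤ>0
codenominator con X = con (1/⁺ X)

fibℕ : ℕ → ℕ
fibℕ 0             = 0
fibℕ 1             = 1
fibℕ (suc (suc n)) = fibℕ (suc n) ℕ.+ fibℕ n

lucℕ : ℕ → ℕ
lucℕ 0             = 2
lucℕ 1             = 1
lucℕ (suc (suc n)) = lucℕ (suc n) ℕ.+ lucℕ n

-- For n = suc m, -[1+ m ] is -n: F₋ₙ = (-1)ⁿ⁻¹ Fₙ and L₋ₙ = (-1)ⁿ Lₙ.

fib : ℤ → ℤ
fib (+ n)    = + fibℕ n
fib -[1+ m ] = -1ℤ ℤ.^ m ℤ.* + fibℕ (suc m)

luc : ℤ → ℤ
luc (+ n)    = + lucℕ n
luc -[1+ m ] = -1ℤ ℤ.^ suc m ℤ.* + lucℕ (suc m)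

-- A conumerator exists, so quantifying over all maps satisfying
-- IsConumerator is not vacuous.  It is computed by the subtractive
-- Euclidean algorithm.

private

  -- For fuel > m + n, suc (euclid fuel m n) is the conumerator of
  -- suc m / suc n.
  euclid : ℕ → ℕ → ℕ → ℕ
  euclid zero    _ _ = 0
  euclid (suc f) m n with compare m n
  ... | equal _     = 0
  ... | greater _ k = suc (euclid f k n ℕ.+ euclid f n k)
  ... | less _ k    = euclid f k m

  euclid-fuel : ∀ f g m n → m ℕ.+ n ℕ.< f → m ℕ.+ n ℕ.< g →
                euclid f m n ≡ euclid g m n
  euclid-fuel (suc f) (suc g) m n (s≤s p) (s≤s q) with compare m n
  ... | equal _     = refl
  ... | greater _ k = cong₂ (λ a b → suc (a ℕ.+ b))
        (euclid-fuel f g k n (smaller p) (smaller q))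
        (euclid-fuel f g n k (smaller′ p) (smaller′ q))
    where
    smaller′ : ∀ {h} → suc (n ℕ.+ k) ℕ.+ n ℕ.≤ h → n ℕ.+ k ℕ.< h
    smaller′ = ℕ.≤-trans (ℕ.m≤m+n _ n)
    smaller : ∀ {h} → suc (n ℕ.+ k) ℕ.+ n ℕ.≤ h → k ℕ.+ n ℕ.< h
    smaller {h} r = subst (ℕ._< h) (ℕ.+-comm n k) (smaller′ r)
  ... | less _ k    = euclid-fuel f g k m (smaller p) (smaller q)
    where
    smaller : ∀ {h} → m ℕ.+ suc (m ℕ.+ k) ℕ.≤ h → k ℕ.+ m ℕ.< h
    smaller {h} r = subst (ℕ._< h) (ℕ.+-comm m k)
                          (ℕ.≤-trans (ℕ.m≤n+m _ m) r)

  con′ : ℕ → ℕ → ℕ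
  con′ m n = euclid (suc (m ℕ.+ n)) m n

  compare-greater : ∀ n k → compare (suc (n ℕ.+ k)) n ≡ greater n k
  compare-greater zero    k = refl
  compare-greater (suc n) k rewrite compare-greater n k = refl

  compare-less : ∀ n k → compare n (suc (n ℕ.+ k)) ≡ less n k
  compare-less zero    k = refl
  compare-less (suc n) k rewrite compare-less n k = refl

  con′-greater : ∀ n k →
    con′ (suc (n ℕ.+ k)) n ≡ suc (con′ k n ℕ.+ con′ n k)
  con′-greater n k rewrite compare-greater n k =
    cong₂ (λ a b → suc (a ℕ.+ b))
      (euclid-fuel _ (suc (k ℕ.+ n)) k n
        (s≤s (ℕ.≤-trans (ℕ.≤-reflexive (ℕ.+-comm k n)) (ℕ.m≤m+n _ n)))
        ℕ.≤-refl)
      (euclid-fuel _ (suc (n ℕ.+ k)) n k (s≤s (ℕ.m≤m+n _ n)) ℕ.≤-refl)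

  con′-less : ∀ n k → con′ n (suc (n ℕ.+ k)) ≡ con′ k n
  con′-less n k rewrite compare-less n k =
    euclid-fuel _ (suc (k ℕ.+ n)) k n
      (ℕ.≤-trans (s≤s (ℕ.≤-reflexive (ℕ.+-comm k n)))
                 (ℕ.m≤n+m _ n))
      ℕ.≤-refl

  conℚ : ℚ → ℤ
  conℚ (mkℚ +[1+ m ] n _) = +[1+ con′ m n ]
  conℚ (mkℚ _ _ _)        = 1ℤ

  conℚ-positive : ∀ q → ℤ.Positive (conℚ q)
  conℚ-positive (mkℚ +0       _ _) = _
  conℚ-positive (mkℚ +[1+ _ ] _ _) = _
  conℚ-positive (mkℚ -[1+ _ ] _ _) = _

  coprime-suc : ∀ m n → Coprime (suc m) (suc n) →
                Coprime (suc (suc (n ℕ.+ m))) (suc n)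
  coprime-suc m n c =
    subst (λ k → Coprime (suc k) (suc n)) (ℕ.+-suc n m) (coprime-+ {suc m} {suc n} c)

  1+-mkℚ : ∀ m n .(c : Coprime (suc m) (suc n)) →
    1ℚ ℚ.+ mkℚ +[1+ m ] n c ≡
    mkℚ +[1+ suc (n ℕ.+ m) ] n (coprime-suc m n c)
  1+-mkℚ m n c = ℚ.toℚᵘ-injective
    (ℚᵘ.≃-trans (ℚ.toℚᵘ-homo-+ 1ℚ (mkℚ +[1+ m ] n c)) (*≡* (cong₂ ℤ._*_
      (cong (λ k → + suc k) (trans
        (cong₂ ℕ._+_ (ℕ.+-identityʳ n) (ℕ.*-identityʳ (suc m)))
        (ℕ.+-suc n m)))
      (cong (λ k → + suc k) (sym (ℕ.+-identityʳ n))))))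

  1/-cong : ∀ {p q} .{{_ : ℚ.NonZero p}} .{{_ : ℚ.NonZero q}} →
            p ≡ q → ℚ.1/ p ≡ ℚ.1/ q
  1/-cong refl = refl

conumerator : ℚ>0 → ℤ>0
conumerator (q , _) = conℚ q , [ conℚ-positive q ]

private

  conumerator-1+X : ∀ X → value (conumerator (1⁺ +⁺ X)) ≡
    value (conumerator X) ℤ.+ value (conumerator (1/⁺ X))
  conumerator-1+X (mkℚ +[1+ m ] n c , _) = trans
    (cong conℚ (1+-mkℚ m n c))
    (cong (λ k → + suc k)
      (trans (con′-greater n m) (sym (ℕ.+-suc (con′ m n) (con′ n m)))))

  conumerator-1/[1+X] : ∀ X →
    value (conumerator (1/⁺ (1⁺ +⁺ X))) ≡ value (conumerator X)
  conumerator-1/[1+X] (mkℚ +[1+ m ] n c , _) = trans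
    (cong conℚ (1/-cong
      {{ℚ.pos⇒nonZero (1ℚ ℚ.+ mkℚ +[1+ m ] n c) {{ℚ.pos+pos⇒pos 1ℚ (mkℚ +[1+ m ] n c)}}}}
      (1+-mkℚ m n c)))
    (cong (λ k → + suc k) (con′-less n m))

conumerator-isConumerator : IsConumerator conumerator
conumerator-isConumerator = record
  { con-1       = refl
  ; con-1+X     = conumerator-1+X
  ; con-1/[1+X] = conumerator-1/[1+X]
  }

{-# OPTIONS --safe #-}

-- The functional equations say that X ↦ 1 + X sends the vector
-- (con X, F X) to (con X + F X, con X), i.e. acts by the Fibonacci
-- matrix, while X ↦ 1/X swaps its entries.  Hence F [n₀; n₁, n₂] is an
-- entry of a product of Fibonacci matrices and swaps, and the formula
-- follows by expressing everything in terms of neighbouring Fibonacci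
-- numbers.

module Submission where

open import Defs
open import Data.Integer using (ℤ; Positive; _+_; _-_; _*_; _^_; +_; -[1+_]; +[1+_]; -1ℤ; 1ℤ)
open import Data.Integer.Tactic.RingSolver using (solve-∀)
open import Data.Irrelevant using ([_])
open import Data.Nat as ℕ using (ℕ; zero; suc)
import Data.Nat.Properties as ℕ
open import Data.Product using (_×_; proj₁; proj₂; _,_)
open import Data.Rational as ℚ using (1ℚ; _/_; toℚᵘ)
import Data.Rational.Properties as ℚ
open import Data.Rational.Unnormalised as ℚᵘ using (mkℚᵘ; *≡*)
import Data.Rational.Unnormalised.Properties as ℚᵘ
open import Data.Refinement using (value; _,_)
open import Data.Refinement.Properties using (value-injective)
open import Relation.Binary.PropositionalEquality
  using (_≡_; refl; sym; trans; cong; cong₂; module ≡-Reasoning)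

-- `_/_` normalises and is stuck on a variable `i`. On unnormalised representatives the claim
-- cross-multiplies to a ring identity over the integers.
[1+i]/1≡1+i/1 : ∀ i → (1ℤ + i) / 1 ≡ 1ℚ ℚ.+ i / 1
[1+i]/1≡1+i/1 i = ℚ.toℚᵘ-injective (begin
  toℚᵘ ((1ℤ + i) / 1)                ≈⟨ ℚ.toℚᵘ-fromℚᵘ (mkℚᵘ (1ℤ + i) 0) ⟩
  mkℚᵘ (1ℤ + i) 0                    ≈⟨ *≡* (integral i) ⟩
  toℚᵘ 1ℚ ℚᵘ.+ mkℚᵘ i 0              ≈⟨ ℚᵘ.+-congʳ (toℚᵘ 1ℚ) (ℚ.toℚᵘ-fromℚᵘ (mkℚᵘ i 0)) ⟨
  toℚᵘ 1ℚ ℚᵘ.+ toℚᵘ (i / 1)          ≈⟨ ℚ.toℚᵘ-homo-+ 1ℚ (i / 1) ⟨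
  toℚᵘ (1ℚ ℚ.+ i / 1)                ∎)
  where
  open ℚᵘ.≃-Reasoning
  integral : ∀ i → (1ℤ + i) * 1ℤ ≡ (1ℤ * 1ℤ + i * 1ℤ) * 1ℤ
  integral = solve-∀

fromℤ⁺-suc : ∀ m → fromℤ⁺ +[1+ suc m ] ≡ 1⁺ +⁺ fromℤ⁺ +[1+ m ]
fromℤ⁺-suc m = value-injective ([1+i]/1≡1+i/1 +[1+ m ])

+⁺-assoc : ∀ X Y Z → (X +⁺ Y) +⁺ Z ≡ X +⁺ (Y +⁺ Z)
+⁺-assoc (p , _) (q , _) (r , _) = value-injective (ℚ.+-assoc p q r)

1/⁺-involutive : ∀ X → 1/⁺ (1/⁺ X) ≡ X
1/⁺-involutive (q , [ q>0 ]) =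
  value-injective (ℚ.1/-involutive q {{ℚ.pos⇒nonZero q {{q>0}}}})

-- Negative indices matter: `n₁ - + 2` and `n₁ - + 3` drop below zero for small `n₁`.
fib-rec : ∀ n → fib n ≡ fib (n - + 1) + fib (n - + 2)
fib-rec (+ 0)           = refl
fib-rec (+ 1)           = refl
fib-rec (+ suc (suc n)) = refl
fib-rec -[1+ m ]
  -- Subtracting 1 and 2 computes to the indices `suc (m ℕ.+ 0)` and `suc (m ℕ.+ 1)` under `-[1+_]`;
  -- the rewrites let `fib` expose its sign powers.
  rewrite ℕ.+-identityʳ m | ℕ.+-comm m 1 =
  alternating (-1ℤ ^ m) (+ fibℕ (suc m)) (+ fibℕ (suc (suc m)))
  where
  alternating : ∀ s a b → s * a ≡ -1ℤ * s * b + -1ℤ * (-1ℤ * s) * (b + a)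
  alternating = solve-∀

fib-+[1+m]+1 : ∀ m → fib (+[1+ m ] + + 1) ≡ + fibℕ (2 ℕ.+ m)
fib-+[1+m]+1 m = cong (λ k → + fibℕ (suc k)) (ℕ.+-comm m 1)

fib-rec-suc : ∀ n → fib (n + + 1) ≡ fib n + fib (n - + 1)
fib-rec-suc n = trans (fib-rec (n + + 1))
  (cong₂ (λ i j → fib i + fib j) (+1-1 n) (+1-2 n))
  where
  +1-1 : ∀ n → n + + 1 - + 1 ≡ n
  +1-1 = solve-∀
  +1-2 : ∀ n → n + + 1 - + 2 ≡ n - + 1
  +1-2 = solve-∀

fib-rec-pred : ∀ n → fib (n - + 1) ≡ fib (n - + 2) + fib (n - + 3)
fib-rec-pred n = trans (fib-rec (n - + 1))
  (cong₂ (λ i j → fib i + fib j) (-1-1 n) (-1-2 n))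
  where
  -1-1 : ∀ n → n - + 1 - + 1 ≡ n - + 2
  -1-1 = solve-∀
  -1-2 : ∀ n → n - + 1 - + 2 ≡ n - + 3
  -1-2 = solve-∀

-- Both sides satisfy the same second-order recurrence, hence two base cases.
lucℕ≡fibℕ+fibℕ : ∀ m → lucℕ (suc m) ≡ fibℕ (suc (suc m)) ℕ.+ fibℕ m
lucℕ≡fibℕ+fibℕ 0             = refl
lucℕ≡fibℕ+fibℕ 1             = refl
lucℕ≡fibℕ+fibℕ (suc (suc m)) = trans
  (cong₂ ℕ._+_ (lucℕ≡fibℕ+fibℕ (suc m)) (lucℕ≡fibℕ+fibℕ m))
  (interchange (fibℕ (3 ℕ.+ m)) (fibℕ (suc m)) (fibℕ (2 ℕ.+ m)) (fibℕ m))
  where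
  open import Algebra.Properties.CommutativeSemigroup ℕ.+-commutativeSemigroup
    using (interchange)

luc≡fib+fib : ∀ n → .{{Positive n}} → luc n ≡ fib (n + + 1) + fib (n - + 1)
luc≡fib+fib +[1+ m ] = trans (cong +_ (lucℕ≡fibℕ+fibℕ m))
  (cong (_+ + fibℕ m) (sym (fib-+[1+m]+1 m)))

-- The left side is what the matrix product yields. Expanding down to two neighbouring Fibonacci
-- numbers for each of `n₀` and `n₁` leaves a polynomial identity.
fib-luc-identity : ∀ n₀ n₁ → .{{Positive n₀}} → ∀ x y →
  fib n₀ * (fib n₁ * x + fib (n₁ - + 1) * y) +
  fib (n₀ - + 1) * (fib (n₁ + + 1) * x + fib n₁ * y) ≡
  (fib (n₁ - + 1) * luc n₀ + fib (n₁ - + 2) * fib (n₀ + + 1)) * x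
  + (fib (n₁ - + 2) * luc n₀ + fib (n₁ - + 3) * fib (n₀ + + 1)) * y
fib-luc-identity n₀ n₁ {{n₀>0}} x y
  -- Order matters: each rewrite also expands terms introduced by the earlier ones.
  rewrite luc≡fib+fib n₀ {{n₀>0}} | fib-rec-suc n₀ | fib-rec-suc n₁ | fib-rec n₁
        | fib-rec-pred n₁ =
  polynomial (fib (n₀ - + 1)) (fib n₀) (fib (n₁ - + 2)) (fib (n₁ - + 3)) x y
  where
  polynomial : ∀ p q b d x y →
    q * ((b + d + b) * x + (b + d) * y) +
    p * ((b + d + b + (b + d)) * x + (b + d + b) * y) ≡
    ((b + d) * (q + p + p) + b * (q + p)) * x
    + (b * (q + p + p) + d * (q + p)) * y
  polynomial = solve-∀

module _ {con : ℚ>0 → ℤ>0} (isCon : IsConumerator con) where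
  open IsConumerator isCon

  private
    c F : ℚ>0 → ℤ
    c X = value (con X)
    F X = value (codenominator con X)

  F-1/ : ∀ X → F (1/⁺ X) ≡ c X
  F-1/ X = cong c (1/⁺-involutive X)

  -- The coefficients are the entries of the Fibonacci matrix to the power `suc m`. The components
  -- are proved together because `con-1+X` mixes them.
  con-fromℤ⁺ℕ+ : ∀ m X →
    c (fromℤ⁺ +[1+ m ] +⁺ X) ≡ + fibℕ (2 ℕ.+ m) * c X + + fibℕ (suc m) * F X ×
    F (fromℤ⁺ +[1+ m ] +⁺ X) ≡ + fibℕ (suc m) * c X + + fibℕ m * F X
  con-fromℤ⁺ℕ+ zero X =
    trans (con-1+X X) (one-one (c X) (F X)) ,
    trans (con-1/[1+X] X) (one-zero (c X) (F X))
    where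
    one-one : ∀ x y → x + y ≡ 1ℤ * x + 1ℤ * y
    one-one = solve-∀
    one-zero : ∀ x y → x ≡ 1ℤ * x + + 0 * y
    one-zero = solve-∀
  con-fromℤ⁺ℕ+ (suc m) X =
    (begin
      c (fromℤ⁺ +[1+ suc m ] +⁺ X)  ≡⟨ cong c unfold ⟩
      c (1⁺ +⁺ Y)                   ≡⟨ con-1+X Y ⟩
      c Y + F Y                     ≡⟨ cong₂ _+_ cY FY ⟩
      -- The sums `a + b` and `b + d` are the next Fibonacci numbers by computation.
      _                             ≡⟨ collect (+ fibℕ (2 ℕ.+ m)) (+ fibℕ (suc m)) (+ fibℕ m) (c X) (F X) ⟩
      _                             ∎) ,
    (begin
      F (fromℤ⁺ +[1+ suc m ] +⁺ X)  ≡⟨ cong F unfold ⟩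
      F (1⁺ +⁺ Y)                   ≡⟨ con-1/[1+X] Y ⟩
      c Y                           ≡⟨ cY ⟩
      _                             ∎)
    where
    open ≡-Reasoning
    Y = fromℤ⁺ +[1+ m ] +⁺ X
    cY = proj₁ (con-fromℤ⁺ℕ+ m X)
    FY = proj₂ (con-fromℤ⁺ℕ+ m X)
    unfold : fromℤ⁺ +[1+ suc m ] +⁺ X ≡ 1⁺ +⁺ Y
    unfold = trans (cong (_+⁺ X) (fromℤ⁺-suc m)) (+⁺-assoc 1⁺ (fromℤ⁺ +[1+ m ]) X)
    collect : ∀ a b d x y →
      (a * x + b * y) + (b * x + d * y) ≡ (a + b) * x + (b + d) * y
    collect = solve-∀

  -- The innermost term has no positive tail, so the induction starts from `con-1`, which serves
  -- both components as `1/⁺ 1⁺` computes to `1⁺`.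
  con-fromℤ⁺ℕ : ∀ m →
    c (fromℤ⁺ +[1+ m ]) ≡ + fibℕ (2 ℕ.+ m) × F (fromℤ⁺ +[1+ m ]) ≡ + fibℕ (suc m)
  con-fromℤ⁺ℕ zero    = con-1 , con-1
  con-fromℤ⁺ℕ (suc m) =
    trans (cong c (fromℤ⁺-suc m))
      (trans (con-1+X (fromℤ⁺ +[1+ m ]))
        (cong₂ _+_ (proj₁ (con-fromℤ⁺ℕ m)) (proj₂ (con-fromℤ⁺ℕ m)))) ,
    trans (cong F (fromℤ⁺-suc m))
      (trans (con-1/[1+X] (fromℤ⁺ +[1+ m ])) (proj₁ (con-fromℤ⁺ℕ m)))

  con-fromℤ⁺ : ∀ n → .{{_ : Positive n}} →
    c (fromℤ⁺ n) ≡ fib (n + + 1) × F (fromℤ⁺ n) ≡ fib n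
  con-fromℤ⁺ +[1+ m ] =
    trans (proj₁ (con-fromℤ⁺ℕ m)) (sym (fib-+[1+m]+1 m)) , proj₂ (con-fromℤ⁺ℕ m)

  con-fromℤ⁺+ : ∀ n → .{{_ : Positive n}} → ∀ X →
    c (fromℤ⁺ n +⁺ X) ≡ fib (n + + 1) * c X + fib n * F X ×
    F (fromℤ⁺ n +⁺ X) ≡ fib n * c X + fib (n - + 1) * F X
  con-fromℤ⁺+ +[1+ m ] X =
    trans (proj₁ (con-fromℤ⁺ℕ+ m X))
      (cong (λ a → a * c X + + fibℕ (suc m) * F X) (sym (fib-+[1+m]+1 m))) ,
    proj₂ (con-fromℤ⁺ℕ+ m X)

lemma3p2 : (con : ℚ>0 → ℤ>0) → IsConumerator con →
    (n₀ n₁ n₂ : ℤ) →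
    .{{_ : Positive n₀}} → .{{_ : Positive n₁}} → .{{_ : Positive n₂}} →
    value (codenominator con (cf n₀ n₁ n₂)) ≡
    (fib (n₁ - + 1) * luc n₀ + fib (n₁ - + 2) * fib (n₀ + + 1)) * fib n₂
    + (fib (n₁ - + 2) * luc n₀ + fib (n₁ - + 3) * fib (n₀ + + 1)) * fib (n₂ + + 1)
lemma3p2 con isCon n₀ n₁ n₂ = begin
  F (cf n₀ n₁ n₂)
    -- The conumerator of `1/⁺ Z` is `F Z` by definition; only `F (1/⁺ Z)` needs `F-1/`. The same
    -- happens with `Y` below.
    ≡⟨ proj₂ (con-fromℤ⁺+ isCon n₀ (1/⁺ Z)) ⟩
  fib n₀ * F Z + fib (n₀ - + 1) * F (1/⁺ Z)
    ≡⟨ cong₂ (λ u v → fib n₀ * u + fib (n₀ - + 1) * v)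
         (trans (proj₂ (con-fromℤ⁺+ isCon n₁ (1/⁺ Y)))
                (cong₂ (λ x y → fib n₁ * x + fib (n₁ - + 1) * y) FY F[1/Y]))
         (trans (F-1/ isCon Z) (trans (proj₁ (con-fromℤ⁺+ isCon n₁ (1/⁺ Y)))
                (cong₂ (λ x y → fib (n₁ + + 1) * x + fib n₁ * y) FY F[1/Y]))) ⟩
  _
    ≡⟨ fib-luc-identity n₀ n₁ (fib n₂) (fib (n₂ + + 1)) ⟩
  _ ∎
  where
  open ≡-Reasoning
  F : ℚ>0 → ℤ
  F X = value (codenominator con X)
  Y Z : ℚ>0
  Y = fromℤ⁺ n₂
  Z = fromℤ⁺ n₁ +⁺ 1/⁺ Y
  FY : F Y ≡ fib n₂
  FY = proj₂ (con-fromℤ⁺ isCon n₂)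
  F[1/Y] : F (1/⁺ Y) ≡ fib (n₂ + + 1)
  F[1/Y] = trans (F-1/ isCon Y) (proj₁ (con-fromℤ⁺ isCon n₂))
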